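{- Let $G$ be a twin-free finite simple graph with no isolated vertices such that $\det(G) = k \geq 2$. Then for every integer $t \geq \lceil \log_2(k+1)\rceil - 1$, \[ \det(\mu^{(t)}(G)) = k, \quad \dist(\mu^{(t)}(G)) = 2, \quad \text{and} \quad \rho(\mu^{(t)}(G)) \leq \frac{(k+1)\lceil \log_2(k+1)\rceil}{2}. \]
   Context: For $t \in \mathbb{N}$ and a graph $G$ with $V(G)=\{v_1,\dots,v_n\}$, the generalized Mycielskian $\mu^{(t)}(G)$ has vertex set $\{u_i^s : 1\le i\le n,\ 0\le s\le t\} \cup \{w\}$, with $u_i^0$ identified with $v_i$. For each edge $v_iv_j$ of $G$ it has edges $u_i^0u_j^0$ and $u_i^su_j^{s+1}$, $u_j^su_i^{s+1}$ for $0 \le s < t$; also edges $u_i^t w$ for $1 \le i \le n$; no other edges. A determining set of a graph $H$ is a vertex set $S$ such that the only automorphism fixing every vertex of $S$ is the identity; $\det(H)$ is the minimum size of one. A coloring of $V(H)$ with $d$ colors is distinguishing if only the identity automorphism preserves each color class; $\dist(H)$ is the least $d$ admitting a distinguishing $d$-coloring. If $\dist(H)=2$, the cost $\rho(H)$ is the minimum, over all distinguishing $2$-colorings, of the size of the smaller color class. Twins are vertices with equal open neighborhoods; twin-free means no pair of distinct twins. -}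

module Defs where

open import Data.Nat using (ℕ; zero; suc; _+_; _*_; _≤_; _⊔_; _⊓_)
open import Data.Bool using (Bool; true; false; _∧_; _∨_; if_then_else_)
open import Data.Fin using (Fin; zero; suc; toℕ; fromℕ; splitAt; remQuot; _≟_)
open import Data.Fin.Subset using (Subset; ∣_∣; _∈_)
open import Data.Vec using (tabulate)
open import Data.Maybe using (Maybe; just; nothing)
open import Data.Product using (Σ; ∃; _×_; _,_; ∃-syntax)
open import Data.Sum using (inj₁; inj₂)
open import Function.Bundles using (_↔_; Inverse)
open import Relation.Binary.PropositionalEquality using (_≡_)
open import Relation.Nullary.Decidable using (⌊_⌋)
import Data.Nat as ℕ

record Graph : Set where
  field
    n      : ℕ
    adj    : Fin n → Fin n → Bool
    sym    : ∀ x y → adj x y ≡ adj y x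
    irrefl : ∀ x → adj x x ≡ false
open Graph public

-- The notions below are stated for an arbitrary adjacency relation on
-- Fin m (they are applied to graphs and to the Mycielskian's adjacency).
Adj : ℕ → Set
Adj m = Fin m → Fin m → Bool

IsAutomorphism : ∀ {m} → Adj m → (Fin m ↔ Fin m) → Set
IsAutomorphism a f = ∀ x y → a (Inverse.to f x) (Inverse.to f y) ≡ a x y

IsIdentity : ∀ {m} → (Fin m ↔ Fin m) → Set
IsIdentity f = ∀ x → Inverse.to f x ≡ x

IsDetermining : ∀ {m} → Adj m → Subset m → Set
IsDetermining {m} a S = ∀ (f : Fin m ↔ Fin m) → IsAutomorphism a f →
  (∀ x → x ∈ S → Inverse.to f x ≡ x) → IsIdentity f

DetEq : ∀ {m} → Adj m → ℕ → Set
DetEq {m} a k = (Σ (Subset m) λ S → ∣ S ∣ ≡ k × IsDetermining a S)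
              × (∀ S → IsDetermining a S → k ≤ ∣ S ∣)

IsDistinguishing : ∀ {m} → Adj m → (d : ℕ) → (Fin m → Fin d) → Set
IsDistinguishing {m} a d c = ∀ (f : Fin m ↔ Fin m) → IsAutomorphism a f →
  (∀ x → c (Inverse.to f x) ≡ c x) → IsIdentity f

DistEq : ∀ {m} → Adj m → ℕ → Set
DistEq {m} a d = (Σ (Fin m → Fin d) λ c → IsDistinguishing a d c)
               × (∀ d′ (c : Fin m → Fin d′) → IsDistinguishing a d′ c → d ≤ d′)

classSize : ∀ {m d} → (Fin m → Fin d) → Fin d → ℕ
classSize c i = ∣ tabulate (λ x → ⌊ c x ≟ i ⌋) ∣

smallerClass : ∀ {m} → (Fin m → Fin 2) → ℕ
smallerClass c = classSize c zero ⊓ classSize c (suc zero)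

CostEq : ∀ {m} → Adj m → ℕ → Set
CostEq {m} a r = (Σ (Fin m → Fin 2) λ c → IsDistinguishing a 2 c × smallerClass c ≡ r)
               × (∀ (c : Fin m → Fin 2) → IsDistinguishing a 2 c → r ≤ smallerClass c)

TwinFree : Graph → Set
TwinFree G = ∀ x y → (∀ z → adj G x z ≡ adj G y z) → x ≡ y

NoIsolated : Graph → Set
NoIsolated G = ∀ x → ∃[ y ] adj G x y ≡ true

-- Generalized Mycielskian μ^(t)(G).
-- Vertices: Fin (suc t * n + 1).  A vertex p in the first suc t * n is
-- u_i^s where (s , i) = remQuot n p (s ∈ {0..t}); the last vertex is w.
MVert : ℕ → ℕ → Set
MVert t m = Maybe (Fin (suc t) × Fin m)

mview : ∀ t m → Fin (suc t * m + 1) → MVert t m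
mview t m p with splitAt (suc t * m) p
... | inj₁ q = just (remQuot {suc t} m q)
... | inj₂ _ = nothing

levelLink : ℕ → ℕ → Bool
levelLink zero zero = true
levelLink zero (suc zero) = true
levelLink (suc zero) zero = true
levelLink zero (suc (suc _)) = false
levelLink (suc (suc _)) zero = false
levelLink (suc a) (suc b) = ⌊ a ℕ.≟ suc b ⌋ ∨ ⌊ b ℕ.≟ suc a ⌋

madj : (G : Graph) (t : ℕ) → MVert t (n G) → MVert t (n G) → Bool
madj G t (just (s , i)) (just (s′ , j)) = adj G i j ∧ levelLink (toℕ s) (toℕ s′)
madj G t (just (s , i)) nothing = ⌊ s ≟ fromℕ t ⌋
madj G t nothing (just (s , i)) = ⌊ s ≟ fromℕ t ⌋
madj G t nothing nothing = false

mycAdj : (G : Graph) (t : ℕ) → Fin (suc t * n G + 1) → Fin (suc t * n G + 1) → Bool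
mycAdj G t x y = madj G t (mview t (n G) x) (mview t (n G) y)

{-# OPTIONS --safe #-}

-- The automorphisms of μ^(t)(G) are exactly the columnwise copies of those of G.
-- The top vertex w is recognised by a local property: every neighbour y of w
-- has a "shadow" x, not adjacent to w, with N(y) ∖ {w} ⊆ N(x).  If some u_j^s had
-- this property, twin-freeness would make j a leaf of a K₂ component, leaving
-- u_j^s with at most 2 < n neighbours.  So w is fixed, hence so are the levels
-- (distances to w), and twin-freeness propagates the action on level 0 upwards.
--
-- Determining sets therefore lift to level 0 and project back to G.  A minimum
-- determining set of G is distinguished by colouring its k columns with distinct
-- nonzero binary words of length ⌈log₂ (k+1)⌉ ≤ t+1; the words can be chosen
-- such that at most half of the k+1 words (zero included) have a 1 in any
-- given position, which bounds the cost.
module Submission where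

open import Defs hiding (sym)
open import Data.Nat using (ℕ; zero; suc; _+_; _*_; _≤_; _<_; _∸_; _⊓_; z≤n; s≤s; ⌊_/2⌋; ⌈_/2⌉)
open import Data.Nat.Properties
open import Data.Nat.Induction using (<-rec)
open import Data.Nat.Logarithm using (⌈log₂_⌉; ⌈log₂⌉-mono-≤; ⌈log₂⌈n/2⌉⌉≡⌈log₂n⌉∸1)
open import Data.Nat.Tactic.RingSolver using (solve-∀)
open import Data.Bool using (true; false; _∧_; _∨_; if_then_else_)
import Data.Bool as Bool
open import Data.Bool.Properties using (⇔→≡; ∧-identityʳ)
open import Data.Fin using (Fin; zero; suc; toℕ; fromℕ; fromℕ<; combine; splitAt; _↑ˡ_; _↑ʳ_)
import Data.Fin as Fin
import Data.Fin.Properties as Fin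
open import Data.Fin.Subset using (Subset; inside; outside; ∣_∣; _∈_; _-_; ⊥; ⊤)
open import Data.Fin.Subset.Properties using (x∈p∧x≢y⇒x∈p-y; x∈p⇒∣p-x∣<∣p∣; ∣⊥∣≡0; ∣⊤∣≡n; ∈⊤; _∈?_)
open import Data.Vec using (Vec; []; _∷_; _++_; concat; lookup; tabulate; here; there)
open import Data.Vec.Properties using (lookup-++ˡ; lookup-++ʳ; lookup∘tabulate; tabulate∘lookup; tabulate-cong; []=⇒lookup; lookup⇒[]=; ∷-injectiveʳ)
open import Data.List using (List; []; _∷_; length; map)
import Data.List as List
open import Data.List.Properties using (length-++; length-map)
open import Data.List.Membership.Propositional using () renaming (_∈_ to _∈ₗ_)
open import Data.List.Membership.Propositional.Properties using (∈-map⁻)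
open import Data.List.Relation.Unary.Any using () renaming (here to hereₗ; there to thereₗ)
open import Data.List.Relation.Unary.All using ([]; _∷_) renaming (lookup to All-lookup)
open import Data.List.Relation.Unary.AllPairs using ([]; _∷_)
open import Data.List.Relation.Unary.Unique.Propositional using (Unique)
open import Data.List.Relation.Unary.Unique.Propositional.Properties using () renaming (map⁺ to Unique-map⁺; ++⁺ to Unique-++⁺)
open import Data.Maybe using (just; nothing)
open import Data.Product using (Σ; ∃; _×_; _,_; proj₁; proj₂)
open import Data.Sum using (inj₁; inj₂)
open import Data.Empty renaming (⊥ to Empty)
open import Function using (_∘_; _∋_)
open import Function.Bundles using (_↔_; Inverse; mk↔ₛ′; mk⇔)
open import Relation.Nullary using (¬_; Dec; yes; no; contradiction; ¬?; _×-dec_)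
open import Relation.Nullary.Decidable using (map′; decidable-stable; ⌊_⌋)
open import Relation.Unary using (Decidable)
open import Relation.Binary.PropositionalEquality using (_≡_; _≢_; refl; sym; trans; cong; cong₂; subst; subst₂; module ≡-Reasoning)

-- Cardinality of subsets, and lookup in concatenated vectors.

-- Each element of `T` uses up its own image, which is then deleted from `S`. The map takes
-- membership proofs because its later uses read the image off such a proof.
injection⇒∣∣≤ : ∀ {m M} (T : Subset m) (S : Subset M) (f : ∀ {x} → x ∈ T → Fin M) →
  (∀ {x} (p : x ∈ T) → f p ∈ S) →
  (∀ {x y} (p : x ∈ T) (q : y ∈ T) → f p ≡ f q → x ≡ y) → ∣ T ∣ ≤ ∣ S ∣
injection⇒∣∣≤ [] S f f∈ inj = z≤n
injection⇒∣∣≤ (outside ∷ T) S f f∈ inj =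
  injection⇒∣∣≤ T S (λ p → f (there p)) (λ p → f∈ (there p))
    (λ p q e → Fin.suc-injective (inj (there p) (there q) e))
injection⇒∣∣≤ (inside ∷ T) S f f∈ inj = ≤-trans
  (s≤s (injection⇒∣∣≤ T (S - f here) (λ p → f (there p))
    (λ p → x∈p∧x≢y⇒x∈p-y (f∈ (there p)) (λ e → contradiction (inj (there p) here e) λ ()))
    (λ p q e → Fin.suc-injective (inj (there p) (there q) e))))
  (x∈p⇒∣p-x∣<∣p∣ (f∈ here))

∣++∣ : ∀ {m n} (p : Subset m) (q : Subset n) → ∣ p ++ q ∣ ≡ ∣ p ∣ + ∣ q ∣
∣++∣ [] q = refl
∣++∣ (inside ∷ p) q = cong suc (∣++∣ p q)
∣++∣ (outside ∷ p) q = ∣++∣ p q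

lookup-concat : ∀ {A : Set} {m n} (xss : Vec (Vec A m) n) i s →
  lookup (concat xss) (combine i s) ≡ lookup (lookup xss i) s
lookup-concat (xs ∷ xss) zero s = lookup-++ˡ xs (concat xss) s
lookup-concat (xs ∷ xss) (suc i) s =
  trans (lookup-++ʳ xs (concat xss) (combine i s)) (lookup-concat xss i s)

-- Light binary codes

weight : ∀ {T} → List (Subset T) → ℕ
weight [] = 0
weight (c ∷ cs) = ∣ c ∣ + weight cs

-- Giving ⌈N/2⌉ words the leading bit 0 and ⌊N/2⌋ the leading bit 1, recursively,
-- keeps the ones a minority in every position.  Junk when 2 ^ T < N.
codes : (T N : ℕ) → List (Subset T)
codes T zero = []
codes T (suc zero) = ⊥ ∷ []
codes zero (suc (suc N)) = []
codes (suc T) N@(suc (suc _)) =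
  map (outside ∷_) (codes T ⌈ N /2⌉) List.++ map (inside ∷_) (codes T ⌊ N /2⌋)

log⌈/2⌉≤ : ∀ {T} N → ⌈log₂ N ⌉ ≤ suc T → ⌈log₂ ⌈ N /2⌉ ⌉ ≤ T
log⌈/2⌉≤ N h rewrite ⌈log₂⌈n/2⌉⌉≡⌈log₂n⌉∸1 N = ∸-monoˡ-≤ 1 h

log⌊/2⌋≤ : ∀ {T} N → ⌈log₂ N ⌉ ≤ suc T → ⌈log₂ ⌊ N /2⌋ ⌉ ≤ T
log⌊/2⌋≤ N h = ≤-trans (⌈log₂⌉-mono-≤ (⌊n/2⌋≤⌈n/2⌉ N)) (log⌈/2⌉≤ N h)

log₂-≰0 : ∀ N → ¬ (⌈log₂ suc (suc N) ⌉ ≤ 0)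
log₂-≰0 N h = contradiction (≤-trans (⌈log₂⌉-mono-≤ {2} {suc (suc N)} (s≤s (s≤s z≤n))) h) λ ()

length-codes : ∀ T N → ⌈log₂ N ⌉ ≤ T → length (codes T N) ≡ N
length-codes T zero h = refl
length-codes T (suc zero) h = refl
length-codes zero (suc (suc N)) h = contradiction h (log₂-≰0 N)
length-codes (suc T) N@(suc (suc _)) h = begin
  length (map (outside ∷_) C List.++ map (inside ∷_) F)
    ≡⟨ length-++ (map (outside ∷_) C) ⟩
  length (map (outside ∷_) C) + length (map (inside ∷_) F)
    ≡⟨ cong₂ _+_ (length-map _ C) (length-map _ F) ⟩
  length C + length F
    ≡⟨ cong₂ _+_ (length-codes T ⌈ N /2⌉ (log⌈/2⌉≤ N h)) (length-codes T ⌊ N /2⌋ (log⌊/2⌋≤ N h)) ⟩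
  ⌈ N /2⌉ + ⌊ N /2⌋
    ≡⟨ +-comm ⌈ N /2⌉ ⌊ N /2⌋ ⟩
  ⌊ N /2⌋ + ⌈ N /2⌉
    ≡⟨ ⌊n/2⌋+⌈n/2⌉≡n N ⟩
  N ∎
  where
  open ≡-Reasoning
  C = codes T ⌈ N /2⌉
  F = codes T ⌊ N /2⌋

codes-unique : ∀ T N → Unique (codes T N)
codes-unique T zero = []
codes-unique T (suc zero) = [] ∷ []
codes-unique zero (suc (suc N)) = []
codes-unique (suc T) N@(suc (suc _)) = Unique-++⁺
  (Unique-map⁺ ∷-injectiveʳ (codes-unique T ⌈ N /2⌉))
  (Unique-map⁺ ∷-injectiveʳ (codes-unique T ⌊ N /2⌋))
  λ (v∈C , v∈F) → clash (∈-map⁻ (outside ∷_) v∈C) (∈-map⁻ (inside ∷_) v∈F)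
  where
  clash : ∀ {v : Subset (suc T)} {P Q : Subset T → Set} →
    ∃ (λ x → P x × v ≡ outside ∷ x) → ∃ (λ x → Q x × v ≡ inside ∷ x) → Empty
  clash (_ , _ , refl) (_ , _ , ())

-- The words with leading bit 0 come first at every split, so the list starts with the zero word.
-- That word is reserved for the columns outside the determining set.
codes-head : ∀ T N → ⌈log₂ suc N ⌉ ≤ T → ∃ λ cs → codes T (suc N) ≡ ⊥ ∷ cs
codes-head T zero h = _ , refl
codes-head zero (suc N) h = contradiction h (log₂-≰0 N)
codes-head (suc T) (suc N) h
  -- `⌈ suc (suc N) /2⌉` reduces to `suc ⌊ suc N /2⌋`, so the recursive call describes exactly the
  -- leading-0 half.
  with codes T ⌈ suc (suc N) /2⌉ | codes-head T ⌊ suc N /2⌋ (log⌈/2⌉≤ (suc (suc N)) h)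
... | _ | _ , refl = _ , refl

weight-++ : ∀ {T} (cs ds : List (Subset T)) → weight (cs List.++ ds) ≡ weight cs + weight ds
weight-++ [] ds = refl
weight-++ (c ∷ cs) ds = trans (cong (∣ c ∣ +_) (weight-++ cs ds)) (sym (+-assoc ∣ c ∣ _ _))

weight-map-outside : ∀ {T} (cs : List (Subset T)) → weight (map (outside ∷_) cs) ≡ weight cs
weight-map-outside [] = refl
weight-map-outside (c ∷ cs) = cong (∣ c ∣ +_) (weight-map-outside cs)

weight-map-inside : ∀ {T} (cs : List (Subset T)) → weight (map (inside ∷_) cs) ≡ length cs + weight cs
weight-map-inside [] = refl
weight-map-inside (c ∷ cs) = cong suc (trans (cong (∣ c ∣ +_) (weight-map-inside cs))
  (swap ∣ c ∣ (length cs) (weight cs)))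
  where
  swap : ∀ a b c → a + (b + c) ≡ b + (a + c)
  swap = solve-∀

2⌊n/2⌋≤n : ∀ n → 2 * ⌊ n /2⌋ ≤ n
2⌊n/2⌋≤n n = begin
  ⌊ n /2⌋ + (⌊ n /2⌋ + 0) ≡⟨ cong (⌊ n /2⌋ +_) (+-identityʳ _) ⟩
  ⌊ n /2⌋ + ⌊ n /2⌋       ≤⟨ +-monoʳ-≤ ⌊ n /2⌋ (⌊n/2⌋≤⌈n/2⌉ n) ⟩
  ⌊ n /2⌋ + ⌈ n /2⌉       ≡⟨ ⌊n/2⌋+⌈n/2⌉≡n n ⟩
  n                       ∎
  where open ≤-Reasoning

-- Each split spends one position and puts at most half of the words on the side of bit 1. After at
-- most `L` splits only single words remain, padded with zeros; hence the bound involves `L` and not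
-- the word length `T`.
codes-weight : ∀ T L N → L ≤ T → ⌈log₂ N ⌉ ≤ L → 2 * weight (codes T N) ≤ N * L
codes-weight T L zero l h = z≤n
codes-weight T L (suc zero) l h rewrite ∣⊥∣≡0 T = z≤n
codes-weight zero zero (suc (suc N)) l h = contradiction h (log₂-≰0 N)
codes-weight (suc T) zero (suc (suc N)) l h = contradiction h (log₂-≰0 N)
codes-weight (suc T) (suc L) N@(suc (suc _)) (s≤s l) h = begin
  2 * weight (map (outside ∷_) C List.++ map (inside ∷_) F)
    ≡⟨ cong (2 *_) (weight-++ (map (outside ∷_) C) (map (inside ∷_) F)) ⟩
  2 * (weight (map (outside ∷_) C) + weight (map (inside ∷_) F))
    ≡⟨ cong (2 *_) (cong₂ _+_ (weight-map-outside C) (weight-map-inside F)) ⟩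
  2 * (weight C + (length F + weight F))
    ≡⟨ cong (λ z → 2 * (weight C + (z + weight F)))
         (length-codes T ⌊ N /2⌋ (≤-trans (log⌊/2⌋≤ N h) l)) ⟩
  2 * (weight C + (⌊ N /2⌋ + weight F))
    ≡⟨ distrib (weight C) ⌊ N /2⌋ (weight F) ⟩
  2 * ⌊ N /2⌋ + (2 * weight F + 2 * weight C)
    ≤⟨ +-mono-≤ (2⌊n/2⌋≤n N) (+-mono-≤
         (codes-weight T L ⌊ N /2⌋ l (log⌊/2⌋≤ N h))
         (codes-weight T L ⌈ N /2⌉ l (log⌈/2⌉≤ N h))) ⟩
  N + (⌊ N /2⌋ * L + ⌈ N /2⌉ * L)
    ≡⟨ cong (N +_) (sym (*-distribʳ-+ L ⌊ N /2⌋ ⌈ N /2⌉)) ⟩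
  N + (⌊ N /2⌋ + ⌈ N /2⌉) * L
    ≡⟨ cong (λ z → N + z * L) (⌊n/2⌋+⌈n/2⌉≡n N) ⟩
  N + N * L
    ≡⟨ sym (*-suc N L) ⟩
  N * suc L ∎
  where
  open ≤-Reasoning
  C = codes T ⌈ N /2⌉
  F = codes T ⌊ N /2⌋
  distrib : ∀ a b c → 2 * (a + (b + c)) ≡ 2 * b + (2 * c + 2 * a)
  distrib = solve-∀

-- Labelling columns by words.

-- Entry `i` is the colour word of column `i`: its bit `s` will be the colour of u_i^s.
labels : ∀ {T n} → Subset n → List (Subset T) → Vec (Subset T) n
labels [] cs = []
labels (outside ∷ S) cs = ⊥ ∷ labels S cs
labels (inside ∷ S) [] = ⊥ ∷ labels S []
labels (inside ∷ S) (c ∷ cs) = c ∷ labels S cs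

∣concat-labels∣≤weight : ∀ {T n} (S : Subset n) (cs : List (Subset T)) →
  ∣ concat (labels S cs) ∣ ≤ weight cs
∣concat-labels∣≤weight [] cs = z≤n
∣concat-labels∣≤weight {T} (outside ∷ S) cs
  rewrite ∣++∣ (⊥ {T}) (concat (labels S cs)) | ∣⊥∣≡0 T = ∣concat-labels∣≤weight S cs
∣concat-labels∣≤weight {T} (inside ∷ S) []
  rewrite ∣++∣ (⊥ {T}) (concat (labels {T} S [])) | ∣⊥∣≡0 T = ∣concat-labels∣≤weight {T} S []
∣concat-labels∣≤weight (inside ∷ S) (c ∷ cs)
  rewrite ∣++∣ c (concat (labels S cs)) = +-monoʳ-≤ ∣ c ∣ (∣concat-labels∣≤weight S cs)

label∈⊥∷ : ∀ {T n} (S : Subset n) (cs : List (Subset T)) i → lookup (labels S cs) i ∈ₗ (⊥ ∷ cs)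
label∈⊥∷ (outside ∷ S) cs zero = hereₗ refl
label∈⊥∷ (outside ∷ S) cs (suc i) = label∈⊥∷ S cs i
label∈⊥∷ (inside ∷ S) [] zero = hereₗ refl
label∈⊥∷ (inside ∷ S) [] (suc i) = label∈⊥∷ S [] i
label∈⊥∷ (inside ∷ S) (c ∷ cs) zero = thereₗ (hereₗ refl)
label∈⊥∷ (inside ∷ S) (c ∷ cs) (suc i) with label∈⊥∷ S cs i
... | hereₗ e = hereₗ e
... | thereₗ m = thereₗ (thereₗ m)

label∈ : ∀ {T n} (S : Subset n) (cs : List (Subset T)) → length cs ≡ ∣ S ∣ →
  ∀ {i} → i ∈ S → lookup (labels S cs) i ∈ₗ cs
label∈ (outside ∷ S) cs l (there p) = label∈ S cs l p
label∈ (inside ∷ S) (c ∷ cs) l here = hereₗ refl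
label∈ (inside ∷ S) (c ∷ cs) l (there p) = thereₗ (label∈ S cs (suc-injective l) p)

-- Only `i` is taken in `S`, since an automorphism might move a column of `S` out of `S`. That case
-- is excluded because the zero word does not occur in `cs`.
labels-injective : ∀ {T n} (S : Subset n) (cs : List (Subset T)) → length cs ≡ ∣ S ∣ →
  Unique (⊥ ∷ cs) → ∀ {i} j → i ∈ S → lookup (labels S cs) j ≡ lookup (labels S cs) i → j ≡ i
labels-injective (outside ∷ S) cs l (⊥∉ ∷ u) zero (there p) e =
  contradiction e (All-lookup ⊥∉ (label∈ S cs l p))
labels-injective (outside ∷ S) cs l u (suc j) (there p) e = cong suc (labels-injective S cs l u j p e)
labels-injective (inside ∷ S) (c ∷ cs) l u zero here e = refl
labels-injective (inside ∷ S) (c ∷ cs) l ((⊥≢c ∷ ⊥∉) ∷ c∉ ∷ u) zero (there p) e =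
  contradiction e (All-lookup c∉ (label∈ S cs (suc-injective l) p))
labels-injective (inside ∷ S) (c ∷ cs) l ((⊥≢c ∷ ⊥∉) ∷ c∉ ∷ u) (suc j) here e
  with label∈⊥∷ S cs j
... | hereₗ e′ = contradiction (trans (sym e′) e) ⊥≢c
... | thereₗ m = contradiction (sym e) (All-lookup c∉ m)
labels-injective (inside ∷ S) (c ∷ cs) l ((_ ∷ ⊥∉) ∷ _ ∷ u) (suc j) (there p) e =
  cong suc (labels-injective S cs (suc-injective l) (⊥∉ ∷ u) j p e)

-- Deciding distinguishability, and existence of the cost

anyVec? : ∀ {d} m {P : Vec (Fin d) m → Set} → Decidable P → Dec (∃ P)
anyVec? zero P? = map′ ([] ,_) (λ { ([] , p) → p }) (P? [])
anyVec? (suc m) P? = map′ (λ (x , v , p) → x ∷ v , p) (λ { (x ∷ v , p) → x , v , p })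
  (Fin.any? λ x → anyVec? m (λ v → P? (x ∷ v)))

-- A nonidentity automorphism preserving the colours amounts to two mutually inverse value tables
-- `v` and `u`. There are finitely many pairs of tables, so a search decides whether one is bad.
isDistinguishing? : ∀ {m} (a : Adj m) d (c : Fin m → Fin d) → Dec (IsDistinguishing a d c)
isDistinguishing? {m} a d c = map′ sound complete (¬? (anyVec? m λ v → anyVec? m (bad? v)))
  where
  Bad : Vec (Fin m) m → Vec (Fin m) m → Set
  Bad v u = (∀ x → lookup v (lookup u x) ≡ x) × (∀ x → lookup u (lookup v x) ≡ x) ×
    (∀ x y → a (lookup v x) (lookup v y) ≡ a x y) × (∀ x → c (lookup v x) ≡ c x) ×
    ¬ (∀ x → lookup v x ≡ x)

  bad? : ∀ v → Decidable (Bad v)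
  bad? v u = Fin.all? (λ x → lookup v (lookup u x) Fin.≟ x) ×-dec
    Fin.all? (λ x → lookup u (lookup v x) Fin.≟ x) ×-dec
    Fin.all? (λ x → Fin.all? λ y → a (lookup v x) (lookup v y) Bool.≟ a x y) ×-dec
    Fin.all? (λ x → c (lookup v x) Fin.≟ c x) ×-dec
    ¬? (Fin.all? λ x → lookup v x Fin.≟ x)

  sound : ¬ (∃ λ v → ∃ (Bad v)) → IsDistinguishing a d c
  -- Being the identity on `Fin m` is decidable, so it is enough to refute its negation.
  sound none f auto col = decidable-stable (Fin.all? λ x → to x Fin.≟ x) λ nid →
    none (tabulate to , tabulate from ,
      (λ x → trans (to≗ _) (trans (cong to (from≗ x)) (Inverse.strictlyInverseˡ f x))) ,
      (λ x → trans (from≗ _) (trans (cong from (to≗ x)) (Inverse.strictlyInverseʳ f x))) ,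
      (λ x y → trans (cong₂ a (to≗ x) (to≗ y)) (auto x y)) ,
      (λ x → trans (cong c (to≗ x)) (col x)) ,
      λ h → nid λ x → trans (sym (to≗ x)) (h x))
    where
    open Inverse f using (to; from)
    to≗ = lookup∘tabulate to
    from≗ = lookup∘tabulate from

  complete : IsDistinguishing a d c → ¬ (∃ λ v → ∃ (Bad v))
  complete dist (v , u , vu , uv , auto , col , nid) =
    nid (dist (mk↔ₛ′ (lookup v) (lookup u) vu uv) auto col)

isDistinguishing-≗ : ∀ {m} (a : Adj m) {d} {c c′ : Fin m → Fin d} → (∀ x → c x ≡ c′ x) →
  IsDistinguishing a d c → IsDistinguishing a d c′
isDistinguishing-≗ a e dist f auto col = dist f auto λ x → trans (e _) (trans (col x) (sym (e x)))

smallerClass-≗ : ∀ {m} {c c′ : Fin m → Fin 2} → (∀ x → c x ≡ c′ x) → smallerClass c ≡ smallerClass c′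
smallerClass-≗ e = cong₂ _⊓_ (classSize-≗ zero) (classSize-≗ (suc zero))
  where
  classSize-≗ : ∀ i → _
  classSize-≗ i = cong ∣_∣ (tabulate-cong λ x → cong (λ z → ⌊ z Fin.≟ i ⌋) (e x))

-- Descent on the size of the smaller class: a finite search either finds a strictly cheaper
-- distinguishing colouring or shows that the current one is optimal.
cost-exists : ∀ {m} (a : Adj m) (c : Fin m → Fin 2) → IsDistinguishing a 2 c →
  ∃ λ r → CostEq a r × r ≤ smallerClass c
cost-exists {m} a c dist = <-rec
  (λ b → ∀ c → IsDistinguishing a 2 c → smallerClass c ≡ b → ∃ λ r → CostEq a r × r ≤ b)
  descend _ c dist refl
  where
  descend : ∀ b → (∀ {b′} → b′ < b → ∀ c → IsDistinguishing a 2 c → smallerClass c ≡ b′ →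
      ∃ λ r → CostEq a r × r ≤ b′) →
    ∀ c → IsDistinguishing a 2 c → smallerClass c ≡ b → ∃ λ r → CostEq a r × r ≤ b
  descend b rec c dist refl
    with anyVec? m (λ v → isDistinguishing? a 2 (lookup v) ×-dec smallerClass (lookup v) <? b)
  ... | yes (v , dist′ , lt) with rec lt (lookup v) dist′ refl
  ...   | r , cost , r≤ = r , cost , ≤-trans r≤ (<⇒≤ lt)
  descend b rec c dist refl | no none = b , ((c , dist , refl) , minimal) , ≤-refl
    where
    minimal : ∀ c′ → IsDistinguishing a 2 c′ → b ≤ smallerClass c′
    minimal c′ dist′ = ≮⇒≥ λ lt → none (tabulate c′ ,
      isDistinguishing-≗ a (λ x → sym (lookup∘tabulate c′ x)) dist′ ,
      subst (_< b) (smallerClass-≗ (λ x → sym (lookup∘tabulate c′ x))) lt)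

-- Injectivity of bijections, and the determining number against the order.

to-injective : ∀ {A B : Set} (f : A ↔ B) {x y} → Inverse.to f x ≡ Inverse.to f y → x ≡ y
to-injective f {x} {y} e = trans (sym (Inverse.strictlyInverseʳ f x))
  (trans (cong (Inverse.from f) e) (Inverse.strictlyInverseʳ f y))

-- All vertices but one form a determining set: a permutation fixing the others has nowhere else to
-- send the last one.
det<order : ∀ {n} {a : Adj n} {k} → DetEq a k → 1 ≤ k → k < n
det<order {zero} (_ , min) 1≤k = contradiction (≤-trans 1≤k (min [] λ _ _ _ ())) λ ()
det<order {suc n} {a} {k} (_ , min) _ = s≤s (subst (k ≤_) (∣⊤∣≡n n) (min (outside ∷ ⊤) determining))
  where
  determining : IsDetermining a (outside ∷ ⊤)
  determining f auto fix (suc x) = fix (suc x) (there ∈⊤)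
  determining f auto fix zero with Inverse.to f zero in e
  ... | zero = refl
  ... | suc x = contradiction
    (to-injective f (trans e (sym (fix (suc x) (there ∈⊤))))) λ ()

∧≡true : ∀ {x y} → x ∧ y ≡ true → x ≡ true × y ≡ true
∧≡true {true} {true} e = refl , refl

-- Levels and adjacency of the Mycielskian

data Link (a b : ℕ) : Set where
  base : a ≡ 0 → b ≡ 0 → Link a b
  up   : b ≡ suc a → Link a b
  down : a ≡ suc b → Link a b

-- The clauses of `levelLink` inspect `a` before the second argument, so the equation needs a case
-- split on `a`.
levelLink-suc : ∀ a b → levelLink (suc a) (suc b) ≡ ⌊ a ≟ suc b ⌋ ∨ ⌊ b ≟ suc a ⌋
levelLink-suc zero b = refl
levelLink-suc (suc a) b = refl

levelLink⇒Link : ∀ a b → levelLink a b ≡ true → Link a b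
levelLink⇒Link zero zero e = base refl refl
levelLink⇒Link zero (suc zero) e = up refl
levelLink⇒Link (suc zero) zero e = down refl
levelLink⇒Link (suc a) (suc b) e rewrite levelLink-suc a b with a ≟ suc b | b ≟ suc a
... | yes p | _ = down (cong suc p)
... | no _ | yes q = up (cong suc q)
levelLink⇒Link (suc a) (suc b) () | no _ | no _

Link⇒levelLink : ∀ {a b} → Link a b → levelLink a b ≡ true
Link⇒levelLink (base refl refl) = refl
Link⇒levelLink {zero} (up refl) = refl
Link⇒levelLink {suc a} (up refl) rewrite levelLink-suc a (suc a) with a ≟ suc (suc a) | suc a ≟ suc a
... | yes _ | _ = refl
... | no _ | yes _ = refl
... | no _ | no ≢ = contradiction refl ≢
Link⇒levelLink {b = zero} (down refl) = refl
Link⇒levelLink {b = suc b} (down refl) with suc b ≟ suc b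
... | yes _ = refl
... | no ≢ = contradiction refl ≢

-- `zero` if `p ≤ s`, `suc zero` if `p > s`: the two boxes of the pigeonhole argument on the
-- neighbours of a vertex at level `s`.
side : ℕ → ℕ → Fin 2
side zero s = zero
side (suc p) zero = suc zero
side (suc p) (suc s) = side p s

side-below : ∀ p → side p (suc p) ≡ zero
side-below zero = refl
side-below (suc p) = side-below p

side-above : ∀ s → side (suc s) s ≡ suc zero
side-above zero = refl
side-above (suc s) = side-above s

-- The levels linked to `s` are `s - 1` and `s + 1`, one on each side. For `s = 0` the loop at level
-- 0 takes the place of the missing lower level.
Link-side-unique : ∀ {p q s} → Link p s → Link q s → side p s ≡ side q s → p ≡ q
Link-side-unique (base refl refl) (base refl _) e = refl
Link-side-unique (base refl refl) (down refl) ()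
Link-side-unique (up refl) (up refl) e = refl
Link-side-unique {p} (up refl) (down refl) e
  with () ← trans (sym (side-below p)) (trans e (side-above (suc p)))
Link-side-unique (down refl) (base refl refl) ()
Link-side-unique {q = q} (down refl) (up refl) e
  with () ← trans (sym (side-above (suc q))) (trans e (side-below q))
Link-side-unique (down refl) (down refl) e = refl

just-injectiveʳ : ∀ {A B : Set} {a c : A} {b d : B} → just (a , b) ≡ just (c , d) → b ≡ d
just-injectiveʳ refl = refl

-- Vertices of the Mycielskian, and lifts of permutations of G.

module Mycielskian (G : Graph) (t : ℕ) where

  V : Set
  V = MVert t (n G)

  M : ℕ
  M = suc t * n G + 1

  vertex : V → Fin M
  vertex (just (s , i)) = combine s i ↑ˡ 1
  vertex nothing = (suc t * n G) ↑ʳ zero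

  mview-vertex : ∀ v → mview t (n G) (vertex v) ≡ v
  mview-vertex (just (s , i))
    rewrite Fin.splitAt-↑ˡ (suc t * n G) (combine s i) 1 = cong just (Fin.remQuot-combine s i)
  mview-vertex nothing rewrite Fin.splitAt-↑ʳ (suc t * n G) 1 zero = refl

  vertex-mview : ∀ p → vertex (mview t (n G) p) ≡ p
  vertex-mview p with splitAt (suc t * n G) p in e
  ... | inj₁ q = trans (cong (_↑ˡ 1) (Fin.combine-remQuot {suc t} (n G) q)) (Fin.splitAt⁻¹-↑ˡ e)
  ... | inj₂ zero = Fin.splitAt⁻¹-↑ʳ e

  vertex-injective : ∀ u v → vertex u ≡ vertex v → u ≡ v
  vertex-injective u v e =
    trans (sym (mview-vertex u)) (trans (cong (mview t (n G)) e) (mview-vertex v))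

  lift : (Fin (n G) → Fin (n G)) → V → V
  lift σ (just (s , i)) = just (s , σ i)
  lift σ nothing = nothing

  lift-inverse : ∀ {σ τ} → (∀ i → σ (τ i) ≡ i) → ∀ v → lift σ (lift τ v) ≡ v
  lift-inverse e (just (s , i)) = cong (λ z → just (s , z)) (e i)
  lift-inverse e nothing = refl

  lift↔ : Fin (n G) ↔ Fin (n G) → Fin M ↔ Fin M
  lift↔ σ = mk↔ₛ′ (conj (Inverse.to σ)) (conj (Inverse.from σ))
    (inverse (Inverse.strictlyInverseˡ σ)) (inverse (Inverse.strictlyInverseʳ σ))
    where
    conj : (Fin (n G) → Fin (n G)) → Fin M → Fin M
    conj ρ p = vertex (lift ρ (mview t (n G) p))
    inverse : ∀ {ρ τ} → (∀ i → ρ (τ i) ≡ i) → ∀ p → conj ρ (conj τ p) ≡ p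
    inverse {ρ} {τ} e p = trans (cong (vertex ∘ lift ρ) (mview-vertex (lift τ (mview t (n G) p))))
      (trans (cong vertex (lift-inverse {ρ} {τ} e (mview t (n G) p))) (vertex-mview p))

  to-lift↔-vertex : ∀ σ v → Inverse.to (lift↔ σ) (vertex v) ≡ vertex (lift (Inverse.to σ) v)
  to-lift↔-vertex σ v = cong (vertex ∘ lift (Inverse.to σ)) (mview-vertex v)

  lift↔-automorphism : ∀ σ → IsAutomorphism (adj G) σ → IsAutomorphism (mycAdj G t) (lift↔ σ)
  lift↔-automorphism σ auto x y = trans (cong₂ (madj G t)
      (mview-vertex (lift (Inverse.to σ) (mview t (n G) x)))
      (mview-vertex (lift (Inverse.to σ) (mview t (n G) y))))
    (pres (mview t (n G) x) (mview t (n G) y))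
    where
    pres : ∀ u v → madj G t (lift (Inverse.to σ) u) (lift (Inverse.to σ) v) ≡ madj G t u v
    pres (just (s , i)) (just (r , j)) = cong (_∧ levelLink (toℕ s) (toℕ r)) (auto i j)
    pres (just _) nothing = refl
    pres nothing (just _) = refl
    pres nothing nothing = refl

  lift↔-identity : ∀ σ → IsIdentity (lift↔ σ) → IsIdentity σ
  lift↔-identity σ id i = just-injectiveʳ (vertex-injective (just (zero , Inverse.to σ i)) (just (zero , i))
    (trans (sym (to-lift↔-vertex σ (just (zero , i)))) (id (vertex (just (zero , i))))))

  lift↔-identity⁻¹ : ∀ σ → IsIdentity σ → IsIdentity (lift↔ σ)
  lift↔-identity⁻¹ σ id p = trans (cong vertex (lift≗id (mview t (n G) p))) (vertex-mview p)
    where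
    lift≗id : ∀ v → lift (Inverse.to σ) v ≡ v
    lift≗id (just (s , i)) = cong (λ k → just (s , k)) (id i)
    lift≗id nothing = refl

  -- Automorphisms of the Mycielskian

  _~_ : V → V → Set
  x ~ y = madj G t x y ≡ true

  ~⇒adj×Link : ∀ {s r i j} → just (s , i) ~ just (r , j) → adj G i j ≡ true × Link (toℕ s) (toℕ r)
  ~⇒adj×Link {s} {r} e with p , q ← ∧≡true e = p , levelLink⇒Link (toℕ s) (toℕ r) q

  adj×Link⇒~ : ∀ {s r i j} → adj G i j ≡ true → Link (toℕ s) (toℕ r) → just (s , i) ~ just (r , j)
  adj×Link⇒~ p q rewrite p = Link⇒levelLink q

  ~w⇒top : ∀ {s i} → just (s , i) ~ nothing → toℕ s ≡ t
  ~w⇒top {s} e with s Fin.≟ fromℕ t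
  ... | yes refl = Fin.toℕ-fromℕ t

  top⇒~w : ∀ {s i} → toℕ s ≡ t → just (s , i) ~ nothing
  top⇒~w {s} e with s Fin.≟ fromℕ t
  ... | yes _ = refl
  ... | no s≢ = contradiction (Fin.toℕ-injective (trans e (sym (Fin.toℕ-fromℕ t)))) s≢

  level : ∀ {a} → a ≤ t → Fin (suc t)
  level a≤t = fromℕ< (s≤s a≤t)

  toℕ-level : ∀ {a} (a≤t : a ≤ t) → toℕ (level a≤t) ≡ a
  toℕ-level a≤t = Fin.toℕ-fromℕ< (s≤s a≤t)

  toℕ≤t : (s : Fin (suc t)) → toℕ s ≤ t
  toℕ≤t = Fin.toℕ≤pred[n]

  -- Stated on `V` and not on `Fin M`, so that level, column and `w` can be matched on directly.
  record Automorphism : Set where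
    field
      to from  : V → V
      to-from  : ∀ v → to (from v) ≡ v
      from-to  : ∀ v → from (to v) ≡ v
      preserve : ∀ u v → madj G t (to u) (to v) ≡ madj G t u v

    preserve⁻¹ : ∀ u v → madj G t (from u) (from v) ≡ madj G t u v
    preserve⁻¹ u v = trans (sym (preserve (from u) (from v))) (cong₂ (madj G t) (to-from u) (to-from v))

    injective : ∀ {u v} → to u ≡ to v → u ≡ v
    injective {u} {v} e = trans (sym (from-to u)) (trans (cong from e) (from-to v))

  open Automorphism

  inverse : Automorphism → Automorphism
  inverse φ = record
    { to = from φ ; from = to φ ; to-from = from-to φ ; from-to = to-from φ ; preserve = preserve⁻¹ φ }

  fromPermutation : ∀ f → IsAutomorphism (mycAdj G t) f → Automorphism
  fromPermutation f auto = record
    { to = λ v → mview t (n G) (Inverse.to f (vertex v))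
    ; from = λ v → mview t (n G) (Inverse.from f (vertex v))
    ; to-from = λ v → trans (cong (mview t (n G) ∘ Inverse.to f) (vertex-mview _))
        (trans (cong (mview t (n G)) (Inverse.strictlyInverseˡ f _)) (mview-vertex v))
    ; from-to = λ v → trans (cong (mview t (n G) ∘ Inverse.from f) (vertex-mview _))
        (trans (cong (mview t (n G)) (Inverse.strictlyInverseʳ f _)) (mview-vertex v))
    ; preserve = λ u v → trans (auto (vertex u) (vertex v))
        (cong₂ (madj G t) (mview-vertex u) (mview-vertex v))
    }

  -- The first-order property that tells w apart from the other vertices.
  Shadowed : V → Set
  Shadowed v = ∀ y → y ~ v → ∃ λ x → ¬ (x ~ v) × (∀ z → y ~ z → z ≢ v → x ~ z)

  Shadowed-to : ∀ φ {v} → Shadowed v → Shadowed (to φ v)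
  Shadowed-to φ {v} sh y y~φv
    with x , x≁v , x~ ← sh (from φ y) (trans (sym (preserve φ (from φ y) v))
           (trans (cong (λ u → madj G t u (to φ v)) (to-from φ y)) y~φv))
    = to φ x , (λ e → x≁v (trans (sym (preserve φ x v)) e)) ,
      λ z y~z z≢ → trans (cong (madj G t (to φ x)) (sym (to-from φ z)))
        (trans (preserve φ x (from φ z))
          (x~ (from φ z) (trans (preserve⁻¹ φ y z) y~z)
            (λ e → z≢ (trans (sym (to-from φ z)) (cong (to φ) e)))))

  -- u_i^t is shadowed by u_i^{t-2}, or by u_i^0 when t = 1.
  Shadowed-w : 1 ≤ t → Shadowed nothing
  Shadowed-w (s≤s {n = t′} z≤n) (just (s , i)) y~w = just (r , i) , r≁w , shadow
    where
    r≤t : t′ ∸ 1 ≤ t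
    r≤t = ≤-trans (m∸n≤m t′ 1) (n≤1+n t′)
    r = level r≤t
    r≁w : ¬ (just (r , i) ~ nothing)
    r≁w e = 1+n≰n (subst (_≤ t′) (trans (sym (toℕ-level r≤t)) (~w⇒top {r} {i} e)) (m∸n≤m t′ 1))
    pred-link : ∀ a → Link (a ∸ 1) a
    pred-link zero = base refl refl
    pred-link (suc a) = up refl
    shadow : ∀ z → just (s , i) ~ z → z ≢ nothing → just (r , i) ~ z
    shadow nothing _ z≢ = contradiction refl z≢
    shadow (just (q , k)) e _ with ~⇒adj×Link {s} {q} e
    ... | ik , base s≡0 _ = contradiction (trans (sym s≡0) (~w⇒top {s} {i} y~w)) λ ()
    ... | ik , up q≡ = contradiction (subst (_≤ t) (trans q≡ (cong suc (~w⇒top {s} {i} y~w))) (toℕ≤t q)) 1+n≰n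
    ... | ik , down s≡ = adj×Link⇒~ {r} {q} ik
      (subst (λ a → Link a (toℕ q)) (sym (toℕ-level r≤t))
        (subst (Link (t′ ∸ 1)) (suc-injective (trans (sym (~w⇒top {s} {i} y~w)) s≡)) (pred-link t′)))

  -- For `s ≥ 1` go down: `r = s - 1` and `q = s - 2`, truncated to 0, where the loop at level 0
  -- supplies the link. For `s = 0` use that loop first and then step up to level 1.
  two-steps : 1 ≤ t → (s : Fin (suc t)) → ∃ λ (r : Fin (suc t)) → ∃ λ (q : Fin (suc t)) →
    Link (toℕ r) (toℕ s) × Link (toℕ r) (toℕ q) × q ≢ s
  two-steps 1≤t zero = zero , level 1≤t , base refl refl , up (toℕ-level 1≤t) ,
    λ e → contradiction (trans (sym (toℕ-level 1≤t)) (cong toℕ e)) λ ()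
  two-steps 1≤t (suc s) = level s≤t , level q≤t ,
    subst (λ a → Link a (suc (toℕ s))) (sym (toℕ-level s≤t)) (up refl) ,
    subst₂ Link (sym (toℕ-level s≤t)) (sym (toℕ-level q≤t)) (pred-link (toℕ s)) ,
    λ e → 1+n≰n (subst (_≤ toℕ s) (trans (sym (toℕ-level q≤t)) (cong toℕ e)) (m∸n≤m (toℕ s) 1))
    where
    s≤t : toℕ s ≤ t
    s≤t = ≤-trans (n≤1+n _) (toℕ≤t (suc s))
    q≤t : toℕ s ∸ 1 ≤ t
    q≤t = ≤-trans (m∸n≤m (toℕ s) 1) s≤t
    pred-link : ∀ a → Link a (a ∸ 1)
    pred-link zero = base refl refl
    pred-link (suc a) = down refl

  -- A shadow of u_a^r contains both u_j^q and u_b^s in its neighbourhood; the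
  -- first makes its column a neighbour of j and the second puts it on a level
  -- linked to s, so it is adjacent to u_j^s after all.
  Shadowed⇒star : 1 ≤ t → ∀ s j → Shadowed (just (s , j)) →
    ∀ a b → adj G a j ≡ true → adj G a b ≡ true → b ≡ j
  Shadowed⇒star 1≤t s j sh a b aj ab with b Fin.≟ j
  ... | yes b≡j = b≡j
  ... | no b≢j
    with r , q , rs , rq , q≢s ← two-steps 1≤t s
    with sh (just (r , a)) (adj×Link⇒~ {r} {s} aj rs)
  ... | x , x≁ , x~ = absurd x x≁
      (x~ (just (q , j)) (adj×Link⇒~ {r} {q} aj rq) (λ { refl → q≢s refl }))
      (x~ (just (s , b)) (adj×Link⇒~ {r} {s} ab rs) (λ { refl → b≢j refl }))
    where
    absurd : ∀ x → ¬ (x ~ just (s , j)) → x ~ just (q , j) → x ~ just (s , b) → b ≡ j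
    -- The shadow cannot be `w`, whose neighbours all lie on the top level, because `q` and `s`
    -- differ.
    absurd nothing _ w~q w~s = contradiction
      (Fin.toℕ-injective (trans (~w⇒top {q} {j} w~q) (sym (~w⇒top {s} {b} w~s)))) q≢s
    absurd (just (p , c)) x≁ x~q x~s = contradiction
      (adj×Link⇒~ {p} {s} (proj₁ (~⇒adj×Link {p} {q} x~q)) (proj₂ (~⇒adj×Link {p} {s} x~s))) x≁

  -- Putting `w` one level above the top turns adjacency to `w` into a `Link` as well.
  height : V → ℕ
  height nothing = suc t
  height (just (s , i)) = toℕ s

  ~⇒Link-height : ∀ {s j} y → y ~ just (s , j) → Link (height y) (toℕ s)
  ~⇒Link-height {s} {j} nothing e = down (cong suc (sym (~w⇒top {s} {j} e)))
  ~⇒Link-height {s} (just (r , i)) e = proj₂ (~⇒adj×Link {r} {s} e)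

  -- If `j` has no neighbour in G other than `a`, every neighbour of u_j^s is `w` or lies in column
  -- `a`, so its height identifies it.
  leaf-nbr-unique : ∀ {s j a} → (∀ i → adj G i j ≡ true → i ≡ a) → ∀ x y →
    x ~ just (s , j) → y ~ just (s , j) → height x ≡ height y → x ≡ y
  leaf-nbr-unique leaf nothing nothing _ _ _ = refl
  leaf-nbr-unique leaf nothing (just (r , _)) _ _ e =
    contradiction (subst (_≤ t) (sym e) (toℕ≤t r)) 1+n≰n
  leaf-nbr-unique leaf (just (r , _)) nothing _ _ e =
    contradiction (subst (_≤ t) e (toℕ≤t r)) 1+n≰n
  leaf-nbr-unique {s} leaf (just (r , i)) (just (q , k)) x~ y~ e = cong just (cong₂ _,_
    (Fin.toℕ-injective e)
    (trans (leaf i (proj₁ (~⇒adj×Link {r} {s} x~))) (sym (leaf k (proj₁ (~⇒adj×Link {q} {s} y~))))))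

  -- Rigidity of the Mycielskian: `w`, levels and columns.

  module _ (tf : TwinFree G) (ni : NoIsolated G) (1≤t : 1 ≤ t) (3≤n : 3 ≤ n G) where

    fixes-w : ∀ φ → to φ nothing ≡ nothing
    fixes-w φ with to φ nothing in φw
    ... | nothing = refl
    ... | just (s , j) = contradiction (just-injectiveʳ (injective φ same)) (Fin.<⇒≢ i<k)
      where
      star : ∀ a b → adj G a j ≡ true → adj G a b ≡ true → b ≡ j
      star = Shadowed⇒star 1≤t s j (subst Shadowed φw (Shadowed-to φ (Shadowed-w 1≤t)))

      a = proj₁ (ni j)
      aj : adj G a j ≡ true
      aj = trans (Graph.sym G a j) (proj₂ (ni j))

      -- By `star`, both `i` and `a` have `j` as their only neighbour, so they are twins.
      leaf : ∀ i → adj G i j ≡ true → i ≡ a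
      leaf i ij = tf i a λ z → ⇔→≡ (mk⇔
        (λ iz → subst (λ z → adj G a z ≡ true) (sym (star i z ij iz)) aj)
        (λ az → subst (λ z → adj G i z ≡ true) (sym (star a z aj az)) ij))

      image : Fin (n G) → V
      image i = to φ (just (fromℕ t , i))

      image~ : ∀ i → image i ~ just (s , j)
      image~ i = trans (cong (madj G t (image i)) (sym φw))
        (trans (preserve φ (just (fromℕ t , i)) nothing) (top⇒~w {fromℕ t} {i} (Fin.toℕ-fromℕ t)))

      -- At least three top vertices are sent to neighbours of u_j^s, which has at most one on each
      -- side.
      collision = Fin.pigeonhole 3≤n (λ i → side (height (image i)) (toℕ s))
      i = proj₁ collision
      k = proj₁ (proj₂ collision)
      i<k = proj₁ (proj₂ (proj₂ collision))

      same : image i ≡ image k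
      same = leaf-nbr-unique {s} {j} leaf (image i) (image k) (image~ i) (image~ k)
        (Link-side-unique (~⇒Link-height (image i) (image~ i)) (~⇒Link-height (image k) (image~ k))
          (proj₂ (proj₂ (proj₂ collision))))

    Levelled : Automorphism → Fin (suc t) → Set
    Levelled φ s = ∀ i → ∃ λ j → to φ (just (s , i)) ≡ just (s , j)

    -- A neighbour of u_i^s on level `s + 1` keeps its level, so the image of u_i^s is on level `s`
    -- or `s + 2`. The latter is impossible, since the inverse preserves level `s + 2` and would
    -- return u_i^s to it.
    levelled-step : ∀ φ s (s<t : suc (toℕ s) ≤ t) → Levelled φ (level s<t) →
      (∀ r → toℕ r ≡ suc (suc (toℕ s)) → Levelled (inverse φ) r) → Levelled φ s
    levelled-step φ s s<t lev lev⁻¹ i with to φ (just (s , i)) in e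
    ... | nothing = contradiction (injective φ (trans e (sym (fixes-w φ)))) λ ()
    ... | just (r , j)
      with k , ik ← ni i
      with k′ , e′ ← lev k
      with proj₂ (~⇒adj×Link {r} {level s<t} (trans (cong₂ (madj G t) (sym e) (sym e′))
             (trans (preserve φ (just (s , i)) (just (level s<t , k)))
               (adj×Link⇒~ {s} {level s<t} ik (up (toℕ-level s<t))))))
    ... | base _ z = contradiction (trans (sym (toℕ-level s<t)) z) λ ()
    ... | up z = j , cong (λ r → just (r , j))
      (Fin.toℕ-injective (suc-injective (trans (sym z) (toℕ-level s<t))))
    ... | down z
      with r≡ ← trans z (cong suc (toℕ-level s<t))
      with _ , e″ ← lev⁻¹ r r≡ j
      with refl ← trans (sym (from-to φ (just (s , i)))) (trans (cong (from φ) e) e″)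
      = contradiction (sym r≡) (2+m≢m (toℕ s))
      where
      2+m≢m : ∀ m → suc (suc m) ≢ m
      2+m≢m m e = 1+n≰n (≤-trans (n≤1+n (suc m)) (≤-reflexive e))

    -- Induction downwards from the top, which is preserved as the neighbourhood of the fixed vertex
    -- `w`. `φ` stays general because each step also uses the inverse, two levels up.
    levelled : ∀ d φ s → toℕ s + d ≡ t → Levelled φ s
    levelled zero φ s e i with to φ (just (s , i)) in e′
    ... | nothing = contradiction (injective φ (trans e′ (sym (fixes-w φ)))) λ ()
    ... | just (r , j) = j , cong (λ r → just (r , j)) (Fin.toℕ-injective (trans
      (~w⇒top {r} {j} (trans (cong₂ (madj G t) (sym e′) (sym (fixes-w φ)))
        (trans (preserve φ (just (s , i)) nothing) (top⇒~w {s} {i} s≡t)))) (sym s≡t)))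
      where
      s≡t = trans (sym (+-identityʳ (toℕ s))) e
    levelled (suc d) φ s e = levelled-step φ s s<t
      (levelled d φ (level s<t) (trans (cong (_+ d) (toℕ-level s<t)) e⁺)) (above d e⁺)
      where
      e⁺ : suc (toℕ s) + d ≡ t
      e⁺ = trans (sym (+-suc (toℕ s) d)) e
      s<t : suc (toℕ s) ≤ t
      s<t = subst (suc (toℕ s) ≤_) e⁺ (m≤m+n (suc (toℕ s)) d)
      above : ∀ d → suc (toℕ s) + d ≡ t →
        ∀ r → toℕ r ≡ suc (suc (toℕ s)) → Levelled (inverse φ) r
      -- Here `s + 1 = t`, so there is no level `s + 2`.
      above zero e r r≡ = contradiction
        (subst (_≤ t) (trans r≡ (cong suc (trans (sym (+-identityʳ _)) e))) (toℕ≤t r)) 1+n≰n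
      above (suc d) e r r≡ = levelled d (inverse φ) r
        (trans (cong (_+ d) r≡) (trans (sym (+-suc (suc (toℕ s)) d)) e))

    column : Automorphism → Fin (suc t) → Fin (n G) → Fin (n G)
    column φ s i = proj₁ (levelled (t ∸ toℕ s) φ s (m+[n∸m]≡n (toℕ≤t s)) i)

    to-column : ∀ φ s i → to φ (just (s , i)) ≡ just (s , column φ s i)
    to-column φ s i = proj₂ (levelled (t ∸ toℕ s) φ s (m+[n∸m]≡n (toℕ≤t s)) i)

    column-inverse : ∀ φ s i → column φ s (column (inverse φ) s i) ≡ i
    column-inverse φ s i = just-injectiveʳ (trans (sym (to-column φ s _))
      (trans (cong (to φ) (sym (to-column (inverse φ) s i))) (to-from φ (just (s , i)))))

    column-inverse′ : ∀ φ s i → column (inverse φ) s (column φ s i) ≡ i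
    column-inverse′ φ s i = just-injectiveʳ (trans (sym (to-column (inverse φ) s _))
      (trans (cong (from φ) (sym (to-column φ s i))) (from-to φ (just (s , i)))))

    column-adj : ∀ φ s r → Link (toℕ s) (toℕ r) → ∀ i j →
      adj G (column φ s i) (column φ r j) ≡ adj G i j
    column-adj φ s r l i j = begin
      adj G (column φ s i) (column φ r j)
        ≡⟨ sym (∧-link _) ⟩
      madj G t (just (s , column φ s i)) (just (r , column φ r j))
        ≡⟨ sym (cong₂ (madj G t) (to-column φ s i) (to-column φ r j)) ⟩
      madj G t (to φ (just (s , i))) (to φ (just (r , j)))
        ≡⟨ preserve φ (just (s , i)) (just (r , j)) ⟩
      madj G t (just (s , i)) (just (r , j))
        ≡⟨ ∧-link _ ⟩
      adj G i j ∎
      where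
      open ≡-Reasoning
      ∧-link : ∀ x → x ∧ levelLink (toℕ s) (toℕ r) ≡ x
      ∧-link x = trans (cong (x ∧_) (Link⇒levelLink l)) (∧-identityʳ x)

    -- The images of u_i^s and of u_i^0 lie in columns with the same neighbours in G: the image of
    -- the neighbourhood of `i` under the level-0 permutation. For u_i^s this uses the induction
    -- hypothesis one level below; twin-freeness then identifies the columns.
    column-const : ∀ a φ s → toℕ s ≡ a → ∀ i → column φ s i ≡ column φ zero i
    column-const zero φ s e i = cong (λ s → column φ s i) (Fin.toℕ-injective {j = zero} e)
    column-const (suc a) φ s e i = tf _ _ λ z → begin
      adj G (column φ s i) z
        ≡⟨ cong (adj G (column φ s i)) (sym (column-inverse φ zero z)) ⟩
      adj G (column φ s i) (column φ zero (τ z))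
        ≡⟨ cong (adj G (column φ s i)) (sym (column-const a φ r (toℕ-level a≤t) (τ z))) ⟩
      adj G (column φ s i) (column φ r (τ z))
        ≡⟨ column-adj φ s r (down (trans e (cong suc (sym (toℕ-level a≤t))))) i (τ z) ⟩
      adj G i (τ z)
        ≡⟨ sym (column-adj φ zero zero (base refl refl) i (τ z)) ⟩
      adj G (column φ zero i) (column φ zero (τ z))
        ≡⟨ cong (adj G (column φ zero i)) (column-inverse φ zero z) ⟩
      adj G (column φ zero i) z ∎
      where
      open ≡-Reasoning
      τ = column (inverse φ) zero
      a≤t : a ≤ t
      a≤t = ≤-trans (n≤1+n a) (subst (_≤ t) e (toℕ≤t s))
      r = level a≤t

    automorphism-is-lift : ∀ f → IsAutomorphism (mycAdj G t) f → ∃ λ σ →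
      IsAutomorphism (adj G) σ × (∀ p → Inverse.to f p ≡ Inverse.to (lift↔ σ) p)
    automorphism-is-lift f auto = σ , column-adj φ zero zero (base refl refl) ,
      λ p → trans (sym (vertex-mview _)) (cong vertex
        (trans (cong (mview t (n G) ∘ Inverse.to f) (sym (vertex-mview p))) (to≗ (mview t (n G) p))))
      where
      φ = fromPermutation f auto
      σ = mk↔ₛ′ (column φ zero) (column (inverse φ) zero)
        (column-inverse φ zero) (column-inverse′ φ zero)
      to≗ : ∀ v → to φ v ≡ lift (column φ zero) v
      to≗ nothing = fixes-w φ
      to≗ (just (s , i)) = trans (to-column φ s i)
        (cong (λ k → just (s , k)) (column-const (toℕ s) φ s refl i))

    -- Determining sets and colourings

    -- The pointwise equation is handed to the argument about `σ`, so that whatever `f` fixes or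
    -- preserves can be read off for `σ`.
    identity-by-lift : ∀ f → IsAutomorphism (mycAdj G t) f →
      (∀ σ → IsAutomorphism (adj G) σ → (∀ p → Inverse.to f p ≡ Inverse.to (lift↔ σ) p) → IsIdentity σ) →
      IsIdentity f
    identity-by-lift f auto σ-id p with σ , σ-auto , f≗ ← automorphism-is-lift f auto =
      trans (f≗ p) (lift↔-identity⁻¹ σ (σ-id σ σ-auto f≗) p)

    -- `suc t * n G` unfolds to `n G + t * n G`, so level 0 is the first block of indices; zeros
    -- fill the other levels and `w`.
    bottom : Subset (n G) → Subset M
    bottom S = (S ++ ⊥ {t * n G}) ++ ⊥ {1}

    ∣bottom∣ : ∀ S → ∣ bottom S ∣ ≡ ∣ S ∣
    ∣bottom∣ S = begin
      ∣ (S ++ ⊥ {t * n G}) ++ ⊥ {1} ∣ ≡⟨ ∣++∣ (S ++ ⊥ {t * n G}) (⊥ {1}) ⟩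
      ∣ S ++ ⊥ {t * n G} ∣ + 0        ≡⟨ +-identityʳ _ ⟩
      ∣ S ++ ⊥ {t * n G} ∣            ≡⟨ ∣++∣ S (⊥ {t * n G}) ⟩
      ∣ S ∣ + ∣ ⊥ {t * n G} ∣         ≡⟨ cong (∣ S ∣ +_) (∣⊥∣≡0 (t * n G)) ⟩
      ∣ S ∣ + 0                       ≡⟨ +-identityʳ _ ⟩
      ∣ S ∣ ∎
      where open ≡-Reasoning

    ∈bottom : ∀ S {i} → i ∈ S → vertex (just (zero , i)) ∈ bottom S
    ∈bottom S {i} i∈S = lookup⇒[]= _ _ (trans (lookup-++ˡ (S ++ ⊥ {t * n G}) (⊥ {1}) (i ↑ˡ (t * n G)))
      (trans (lookup-++ˡ S (⊥ {t * n G}) i) ([]=⇒lookup i∈S)))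

    bottom-determining : ∀ S → IsDetermining (adj G) S → IsDetermining (mycAdj G t) (bottom S)
    bottom-determining S det f auto fix = identity-by-lift f auto λ σ σ-auto f≗ →
      det σ σ-auto λ i i∈S → just-injectiveʳ (vertex-injective
        (just (zero , Inverse.to σ i)) (just (zero , i))
        (trans (sym (to-lift↔-vertex σ (just (zero , i)))) (trans (sym (f≗ _)) (fix _ (∈bottom S i∈S)))))

    module _ (S : Subset M) where

      Occurs : Fin (n G) → Set
      Occurs i = ∃ λ s → vertex (just (s , i)) ∈ S

      occurs? : Decidable Occurs
      occurs? i = Fin.any? λ s → vertex (just (s , i)) ∈? S

      projection : Subset (n G)
      projection = tabulate λ i → ⌊ occurs? i ⌋

      ∈projection⇒Occurs : ∀ {i} → i ∈ projection → Occurs i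
      ∈projection⇒Occurs {i} p with e ← trans (sym (lookup∘tabulate (λ i → ⌊ occurs? i ⌋) i)) ([]=⇒lookup p)
        with occurs? i
      ... | yes o = o

      Occurs⇒∈projection : ∀ {i} → Occurs i → i ∈ projection
      Occurs⇒∈projection {i} o = lookup⇒[]= i projection
        (trans (lookup∘tabulate (λ i → ⌊ occurs? i ⌋) i) (decided (occurs? i)))
        where
        decided : (d : Dec (Occurs i)) → ⌊ d ⌋ ≡ true
        decided (yes _) = refl
        decided (no ¬o) = contradiction o ¬o

      ∣projection∣≤ : ∣ projection ∣ ≤ ∣ S ∣
      ∣projection∣≤ = injection⇒∣∣≤ projection S
        (λ {i} p → vertex (just (proj₁ (∈projection⇒Occurs p) , i)))
        (λ p → proj₂ (∈projection⇒Occurs p))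
        (λ {i} {j} p q e → just-injectiveʳ (vertex-injective
          (just (proj₁ (∈projection⇒Occurs p) , i)) (just (proj₁ (∈projection⇒Occurs q) , j)) e))

      -- The lift of a `σ` fixing the projection fixes all of `S`: a vertex of `S` is either `w` or
      -- lies in a column fixed by `σ`.
      projection-determining : IsDetermining (mycAdj G t) S → IsDetermining (adj G) projection
      projection-determining det σ auto fix = lift↔-identity σ (det (lift↔ σ) (lift↔-automorphism σ auto)
        λ p p∈S → trans (cong vertex (fixed (mview t (n G) p) (subst (_∈ S) (sym (vertex-mview p)) p∈S)))
          (vertex-mview p))
        where
        fixed : ∀ v → vertex v ∈ S → lift (Inverse.to σ) v ≡ v
        fixed nothing _ = refl
        fixed (just (s , i)) v∈S = cong (λ k → just (s , k)) (fix i (Occurs⇒∈projection (s , v∈S)))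

    det-mycielskian : ∀ {k} → DetEq (adj G) k → DetEq (mycAdj G t) k
    det-mycielskian ((S , ∣S∣≡k , det) , min) =
      (bottom S , trans (∣bottom∣ S) ∣S∣≡k , bottom-determining S det) ,
      λ S′ det′ → ≤-trans (min (projection S′) (projection-determining S′ det′)) (∣projection∣≤ S′)

    colour : Vec (Subset (suc t)) (n G) → V → Fin 2
    colour ls nothing = zero
    colour ls (just (s , i)) = if lookup (lookup ls i) s then suc zero else zero

    -- A colour-preserving lift carries each column to one with the same word. Words of `S` occur
    -- only once, so `S` is fixed pointwise, and `S` is determining.
    colour-distinguishing : ∀ S ls → IsDetermining (adj G) S →
      (∀ {i} j → i ∈ S → lookup ls j ≡ lookup ls i → j ≡ i) →
      IsDistinguishing (mycAdj G t) 2 (colour ls ∘ mview t (n G))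
    colour-distinguishing S ls det inj f auto col = identity-by-lift f auto λ σ σ-auto f≗ →
      det σ σ-auto λ i i∈S → inj (Inverse.to σ i) i∈S (lookup-ext λ s → bit-injective (begin
        colour ls (just (s , Inverse.to σ i))
          ≡⟨ cong (colour ls) (sym (mview-vertex (just (s , Inverse.to σ i)))) ⟩
        colour ls (mview t (n G) (vertex (just (s , Inverse.to σ i))))
          ≡⟨ cong (colour ls ∘ mview t (n G)) (sym (trans (f≗ _) (to-lift↔-vertex σ (just (s , i))))) ⟩
        colour ls (mview t (n G) (Inverse.to f (vertex (just (s , i)))))
          ≡⟨ col (vertex (just (s , i))) ⟩
        colour ls (mview t (n G) (vertex (just (s , i))))
          ≡⟨ cong (colour ls) (mview-vertex (just (s , i))) ⟩
        colour ls (just (s , i)) ∎))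
      where
      open ≡-Reasoning
      bit-injective : ∀ {a b} → (if a then suc zero else zero) ≡ (if b then suc zero else (Fin 2 ∋ zero)) → a ≡ b
      bit-injective {true} {true} _ = refl
      bit-injective {false} {false} _ = refl
      lookup-ext : ∀ {m} {u v : Subset m} → (∀ s → lookup u s ≡ lookup v s) → u ≡ v
      lookup-ext {u = u} {v} e =
        trans (sym (tabulate∘lookup u)) (trans (tabulate-cong e) (tabulate∘lookup v))

    -- `concat ls` runs column by column while vertices are numbered level by level, so the
    -- injection swaps the arguments of `combine`.
    colour-classSize : ∀ ls → classSize (colour ls ∘ mview t (n G)) (suc zero) ≤ ∣ concat ls ∣
    colour-classSize ls = injection⇒∣∣≤ _ (concat ls)
      (λ p → combine (proj₁ (proj₂ (view p))) (proj₁ (view p)))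
      (λ p → lookup⇒[]= _ _ (trans (lookup-concat ls (proj₁ (proj₂ (view p))) (proj₁ (view p)))
        (proj₂ (proj₂ (proj₂ (view p))))))
      (λ p q e → same (view p) (view q) e)
      where
      Red : V → Set
      Red v = ∃ λ s → ∃ λ i → v ≡ just (s , i) × lookup (lookup ls i) s ≡ true

      red : ∀ v → ⌊ colour ls v Fin.≟ suc zero ⌋ ≡ true → Red v
      red (just (s , i)) e with lookup (lookup ls i) s in e′
      ... | true = s , i , refl , e′

      view : ∀ {x} → x ∈ tabulate (λ x → ⌊ colour ls (mview t (n G) x) Fin.≟ suc zero ⌋) → Red (mview t (n G) x)
      view {x} p = red (mview t (n G) x) (trans (sym (lookup∘tabulate _ x)) ([]=⇒lookup p))

      same : ∀ {x y} (p : Red (mview t (n G) x)) (q : Red (mview t (n G) y)) →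
        combine (proj₁ (proj₂ p)) (proj₁ p) ≡ combine (proj₁ (proj₂ q)) (proj₁ q) → x ≡ y
      same {x} {y} (s , i , ex , _) (r , j , ey , _) e
        with refl , refl ← Fin.combine-injective i s j r e =
        trans (sym (vertex-mview x)) (trans (cong vertex (trans ex (sym ey))) (vertex-mview y))

    cheap-colouring : ∀ {k} → DetEq (adj G) k → ⌈log₂ suc k ⌉ ≤ suc t →
      ∃ λ c → IsDistinguishing (mycAdj G t) 2 c × 2 * smallerClass c ≤ suc k * ⌈log₂ suc k ⌉
    cheap-colouring {k} ((S , ∣S∣≡k , det) , _) h with cs , e ← codes-head (suc t) k h =
      colour ls ∘ mview t (n G) ,
      colour-distinguishing S ls det (labels-injective S cs
        -- Removing the zero word from the `suc k` codes leaves `k` of them, one for each element of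
        -- `S`.
        (trans (suc-injective (trans (cong length (sym e)) (length-codes (suc t) (suc k) h))) (sym ∣S∣≡k))
        (subst Unique e (codes-unique (suc t) (suc k)))) ,
      (begin
        2 * smallerClass (colour ls ∘ mview t (n G))
          ≤⟨ *-monoʳ-≤ 2 (m⊓n≤n (classSize (colour ls ∘ mview t (n G)) zero) _) ⟩
        2 * classSize (colour ls ∘ mview t (n G)) (suc zero)
          ≤⟨ *-monoʳ-≤ 2 (≤-trans (colour-classSize ls) (∣concat-labels∣≤weight S cs)) ⟩
        -- The zero word is put back so that the bound for all `suc k` codes applies.
        2 * weight cs
          ≤⟨ *-monoʳ-≤ 2 (m≤n+m (weight cs) ∣ ⊥ {suc t} ∣) ⟩
        2 * weight (⊥ ∷ cs)
          ≡⟨ cong (λ ds → 2 * weight ds) (sym e) ⟩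
        2 * weight (codes (suc t) (suc k))
          ≤⟨ codes-weight (suc t) ⌈log₂ suc k ⌉ (suc k) h ≤-refl ⟩
        suc k * ⌈log₂ suc k ⌉ ∎)
      where
      open ≤-Reasoning
      ls = labels S cs

    -- The vertex `w` needs some colour. With a single colour every lift is colour-preserving, so G
    -- has only the identity automorphism and the empty set is determining, against `1 ≤ k`.
    dist≥2 : ∀ {k} → DetEq (adj G) k → 1 ≤ k →
      ∀ d (c : Fin M → Fin d) → IsDistinguishing (mycAdj G t) d c → 2 ≤ d
    dist≥2 det 1≤k zero c dist with () ← c (vertex nothing)
    dist≥2 (_ , min) 1≤k (suc zero) c dist = contradiction
      (≤-trans 1≤k (subst (_ ≤_) (∣⊥∣≡0 (n G)) (min ⊥ ⊥-determining))) λ ()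
      where
      one-colour : (x y : Fin 1) → x ≡ y
      one-colour zero zero = refl
      ⊥-determining : IsDetermining (adj G) ⊥
      ⊥-determining σ auto _ = lift↔-identity σ
        (dist (lift↔ σ) (lift↔-automorphism σ auto) λ x → one-colour _ _)
    dist≥2 det 1≤k (suc (suc d)) c dist = s≤s (s≤s z≤n)

theorem3 : (G : Graph) → TwinFree G → NoIsolated G →
    (k : ℕ) → DetEq (adj G) k → 2 ≤ k →
    (t : ℕ) → ⌈log₂ (k + 1) ⌉ ∸ 1 ≤ t →
    DetEq (mycAdj G t) k × DistEq (mycAdj G t) 2 ×
    Σ ℕ (λ r → CostEq (mycAdj G t) r × 2 * r ≤ (k + 1) * ⌈log₂ (k + 1) ⌉)
theorem3 G tf ni k det 2≤k t h rewrite +-comm k 1 =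
  det-mycielskian tf ni 1≤t 3≤n det ,
  ((c , c-dist) , dist≥2 tf ni 1≤t 3≤n det 1≤k) ,
  r , cost , ≤-trans (*-monoʳ-≤ 2 r≤) c-cost
  where
  open Mycielskian G t
  1≤k = ≤-trans (s≤s z≤n) 2≤k
  3≤n : 3 ≤ n G
  3≤n = ≤-trans (s≤s 2≤k) (det<order det 1≤k)
  1≤t : 1 ≤ t
  -- Since `k + 1 ≥ 3` and ⌈log₂ 3⌉ = 2, the lower bound on `t` is at least 1.
  1≤t = ≤-trans (∸-monoˡ-≤ 1 (⌈log₂⌉-mono-≤ {3} {suc k} (s≤s 2≤k))) h
  log≤ : ⌈log₂ suc k ⌉ ≤ suc t
  -- Levels 0 to `t` give `t + 1` bit positions, enough for words of length ⌈log₂ (k+1)⌉.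
  log≤ = ≤-trans (m≤n+m∸n ⌈log₂ suc k ⌉ 1) (s≤s h)
  colouring = cheap-colouring tf ni 1≤t 3≤n det log≤
  c = proj₁ colouring
  c-dist = proj₁ (proj₂ colouring)
  c-cost = proj₂ (proj₂ colouring)
  best = cost-exists (mycAdj G t) c c-dist
  r = proj₁ best
  cost = proj₁ (proj₂ best)
  r≤ = proj₂ (proj₂ best)
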